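{- Let $G$ be a connected edge-weighted triangle-free graph with maximum degree $\Delta(G)\le 3$ and weights $w:E(G)\to\mathbb{R}_+$, and let $T$ be an arbitrary spanning tree of $G$. Then $\mathrm{mac}(G)\ge\frac{w(G)}{2}+0.3193\cdot w(T)$.
   Context: $\mathbb{R}_+$ denotes the non-negative reals; for a subgraph $H$, $w(H)=\sum_{e\in E(H)}w(e)$. $\mathrm{mac}(G)$ is the maximum total weight of the edges between $A$ and $B$ over all partitions $(A,B)$ of $V(G)$. Triangle-free means containing no $K_3$ subgraph.
   Formalization: The edge weights w(e) are taken to be non-negative rational numbers instead of non-negative reals. -}

module Defs where

open import Data.Nat using (ℕ; zero; suc; NonZero)
import Data.Nat as ℕ
open import Data.Fin using (Fin; _<_)
open import Data.Bool using (Bool; true; false; if_then_else_)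
open import Data.Product using (Σ; _×_; _,_; proj₁; proj₂; ∃-syntax)
open import Data.Sum using (_⊎_)
open import Data.List using (List; []; _∷_; _++_; [_]; length; filterᵇ)
open import Data.List.Relation.Unary.All using (All)
open import Data.List.Relation.Unary.Unique.Propositional using (Unique)
open import Data.List.Relation.Unary.Linked using (Linked)
open import Data.List.Relation.Binary.Sublist.Propositional using (_⊆_)
open import Data.List.Membership.Propositional using (_∈_)
open import Data.Integer using (+_)
open import Data.Rational using (ℚ; 0ℚ; _+_; _*_; _≤_; _/_; ½)
open import Relation.Binary.PropositionalEquality using (_≡_; _≢_)
open import Relation.Nullary using (¬_)
open import Relation.Nullary.Decidable using (⌊_⌋)
open import Data.Fin using (_≟_)
import Data.Bool as B

-- An edge {i , j} of a simple graph on vertex set Fin n is stored as (i , j) with i < j.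
Edge : ℕ → Set
Edge n = Fin n × Fin n

-- Simple graph on vertex set Fin n: a duplicate-free list of edges (i , j) with i < j
-- (so no loops and no multi-edges).
record Graph (n : ℕ) : Set where
  field
    edges   : List (Edge n)
    ordered : All (λ e → proj₁ e < proj₂ e) edges
    unique  : Unique edges
open Graph public

Adj : {n : ℕ} → List (Edge n) → Fin n → Fin n → Set
Adj E u v = ((u , v) ∈ E) ⊎ ((v , u) ∈ E)

data Reach {n : ℕ} (E : List (Edge n)) : Fin n → Fin n → Set where
  here : ∀ {u} → Reach E u u
  step : ∀ {u v x} → Adj E u x → Reach E x v → Reach E u v

Connected : {n : ℕ} → List (Edge n) → Set
Connected {n} E = (u v : Fin n) → Reach E u v

HasCycle : {n : ℕ} → List (Edge n) → Set
HasCycle {n} E =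
  ∃[ x ] ∃[ vs ] (2 ℕ.≤ length vs × Unique (x ∷ vs) × Linked (Adj E) ((x ∷ vs) ++ [ x ]))

Acyclic : {n : ℕ} → List (Edge n) → Set
Acyclic E = ¬ HasCycle E

IsSpanningTree : {n : ℕ} → Graph n → List (Edge n) → Set
IsSpanningTree G T = (T ⊆ edges G) × Connected T × Acyclic T

incident : {n : ℕ} → Fin n → Edge n → Bool
incident v (i , j) = ⌊ v ≟ i ⌋ B.∨ ⌊ v ≟ j ⌋

degree : {n : ℕ} → Graph n → Fin n → ℕ
degree G v = length (filterᵇ (incident v) (edges G))

MaxDegreeAtMost : {n : ℕ} → Graph n → ℕ → Set
MaxDegreeAtMost {n} G d = (v : Fin n) → degree G v ℕ.≤ d

TriangleFree : {n : ℕ} → Graph n → Set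
TriangleFree {n} G = ¬ (∃[ a ] ∃[ b ] ∃[ c ]
  (Adj (edges G) a b × Adj (edges G) b c × Adj (edges G) a c))

-- edge weights (given on ordered vertex pairs; only values on edges matter)
Weight : ℕ → Set
Weight n = Fin n → Fin n → ℚ

NonNegOn : {n : ℕ} → Weight n → List (Edge n) → Set
NonNegOn w E = All (λ e → 0ℚ ≤ w (proj₁ e) (proj₂ e)) E

wt : {n : ℕ} → Weight n → List (Edge n) → ℚ
wt w []            = 0ℚ
wt w ((i , j) ∷ E) = w i j + wt w E

-- a partition (A , B) of V(G) given by its indicator: A = {v | S v = true}
-- cut weight: total weight of edges with one endpoint in A and the other in B
cutWeight : {n : ℕ} → Weight n → List (Edge n) → (Fin n → Bool) → ℚ
cutWeight w []            S = 0ℚ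
cutWeight w ((i , j) ∷ E) S =
  (if S i B.xor S j then w i j else 0ℚ) + cutWeight w E S

c₀ : ℚ
c₀ = + 3193 / 10000

-- Root T at a leaf and colour its edges with three colours so that every edge whose lower end is not "turned"
-- differs from the two edges above it; by default the colour is just the depth modulo 3. Deleting one colour
-- class cuts T into subtrees; two-colour each of them properly and flip them at random, so that an edge between
-- two subtrees is cut with probability 1/2. Averaged over the three classes, a tree edge is cut with probability
-- 5/6 > 1/2 + 0.3193. A non-tree edge inside one subtree is cut if its ends are at odd distance in T. At even
-- distance, triangle-freeness leaves only one case where the ends can share a subtree: cousins, with a common
-- grandparent in T. If an inner vertex v lies on a cousin edge, this is the only non-tree edge at v, and v can be
-- turned (the edge above it takes the colour of the edge two steps higher) without harming another non-tree edge.
-- For cousin leaves, the flips of their two subtrees are made opposite in one class, which compensates for the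
-- class in which they share a subtree.

{-# OPTIONS --safe #-}
module Submission where

open import Defs
open import Data.Nat using (ℕ; zero; suc; z≤n; s≤s)
import Data.Nat as ℕ
import Data.Nat.Properties as ℕₚ
open import Data.Bool using (Bool; true; false; not; T; if_then_else_) renaming (_xor_ to _⊕_)
import Data.Bool.Properties as Boolₚ
open import Data.Fin using (Fin; zero; suc; _<_; _<?_; join; splitAt; #_)
open import Data.Fin.Properties using (_≟_; all?; any?; <-cmp; splitAt-join)
import Data.Fin.Properties as Finₚ
open import Data.Vec as Vec using (Vec; []; _∷_; _[_]%=_)
import Data.Vec.Properties as Vecₚ
open import Data.Maybe using (Maybe; just; nothing)
open import Data.Product using (∃-syntax; _×_; _,_; proj₁; proj₂)
import Data.Product.Properties as Productₚ
open import Data.Sum using (_⊎_; inj₁; inj₂; swap; [_,_]′)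
open import Data.Sum.Properties using (inj₁-injective; inj₂-injective)
open import Data.Empty using (⊥; ⊥-elim)
open import Data.List using (List; []; _∷_; _++_; [_]; length; filterᵇ; lookup)
open import Data.List.Membership.Propositional using (_∈_)
import Data.List.Membership.DecPropositional as DecMembership
open import Data.List.Membership.Propositional.Properties using (∈-filter⁺; ∈-lookup)
open import Data.List.Relation.Unary.All using (All; []; _∷_)
import Data.List.Relation.Unary.All as All
open import Data.List.Relation.Unary.AllPairs using ([]; _∷_)
open import Data.List.Relation.Unary.Any using (here; there; index)
open import Data.List.Relation.Unary.Any.Properties using (lookup-index)
open import Data.List.Relation.Unary.Linked using (Linked; [-]; _∷_)
open import Data.List.Relation.Unary.Unique.Propositional using (Unique)
open import Data.List.Relation.Binary.Sublist.Propositional using (_⊆_; []; _∷_; _∷ʳ_) renaming (lookup to ⊆-lookup)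
open import Data.Rational using (ℚ; 0ℚ; 1ℚ; ½; _+_; _*_; _≤_; nonNegative)
import Data.Rational.Properties as ℚₚ
open import Data.Rational.Solver using (module +-*-Solver)
open import Function using (_∘_; Injective)
open import Relation.Binary using (tri<; tri≈; tri>)
open import Relation.Binary.PropositionalEquality hiding ([_])
open import Relation.Nullary using (¬_; Dec; yes; no; does; contradiction)
open import Relation.Nullary.Decidable using (_×-dec_; _⊎-dec_; _→-dec_; ¬?; T?; from-yes; dec-true; dec-false)
open import Relation.Unary using (Decidable)
open +-*-Solver

private variable n m : ℕ

-- Rooted spanning trees

adj? : (E : List (Edge n)) (u v : Fin n) → Dec (Adj E u v)
adj? E u v = ((u , v) ∈? E) ⊎-dec ((v , u) ∈? E)
  where open DecMembership (Productₚ.≡-dec Finₚ._≟_ Finₚ._≟_) using (_∈?_)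

least : ∀ {P : ℕ → Set} → Decidable P → ∀ k → P k → ∃[ m ] (P m × ∀ j → P j → m ℕ.≤ j)
least P? zero    pk = 0 , pk , λ _ _ → z≤n
least P? (suc k) pk with P? 0
... | yes p0 = 0 , p0 , λ _ _ → z≤n
... | no ¬p0 with least (P? ∘ suc) k pk
...   | m , pm , min = suc m , pm , λ { zero p0 → contradiction p0 ¬p0 ; (suc j) pj → s≤s (min j pj) }

argmax : (f : Fin (suc n) → ℕ) → ∃[ i ] (∀ j → f j ℕ.≤ f i)
argmax {zero}  f = zero , λ { zero → ℕₚ.≤-refl }
argmax {suc n} f with argmax (f ∘ suc)
... | i , max with ℕₚ.≤-total (f zero) (f (suc i))
...   | inj₁ le = suc i , λ { zero → le ; (suc j) → max j }
...   | inj₂ ge = zero , λ { zero → ℕₚ.≤-refl ; (suc j) → ℕₚ.≤-trans (max j) ge }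

-- The root is its own parent, which makes `parent` total; so `parent v` stands for a tree edge only
-- together with `v ≢ r`.
record Rooting (T : List (Edge n)) (r : Fin n) : Set where
  field
    parent      : Fin n → Fin n
    depth       : Fin n → ℕ
    parent-root : parent r ≡ r
    depth-root  : depth r ≡ 0
    depth-suc   : ∀ {v} → v ≢ r → depth v ≡ suc (depth (parent v))
    adj-parent  : ∀ {v} → v ≢ r → Adj T v (parent v)

  ParentOf : Fin n → Fin n → Set
  ParentOf u v = v ≢ r × u ≡ parent v

module _ (T : List (Edge n)) (r : Fin n) where

  Walk : ℕ → Fin n → Set
  Walk zero    v = v ≡ r
  Walk (suc k) v = ∃[ u ] (Adj T v u × Walk k u)

  walk? : ∀ k v → Dec (Walk k v)
  walk? zero    v = v Finₚ.≟ r
  walk? (suc k) v = Finₚ.any? λ u → adj? T v u ×-dec walk? k u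

  reach⇒walk : ∀ {v} → Reach T v r → ∃[ k ] Walk k v
  reach⇒walk here = 0 , refl
  reach⇒walk (step a p) with reach⇒walk p
  ... | k , w = suc k , _ , a , w

  module _ (conn : Connected T) where
    private
      shortest : ∀ v → ∃[ m ] (Walk m v × ∀ j → Walk j v → m ℕ.≤ j)
      shortest v with reach⇒walk (conn v r)
      ... | k , w = least (λ j → walk? j v) k w

      dist : Fin n → ℕ
      dist v = proj₁ (shortest v)

      next : ∀ {v} m → Walk m v → Fin n
      next {v} zero    _       = v
      next     (suc m) (u , _) = u

      par : Fin n → Fin n
      par v = next (dist v) (proj₁ (proj₂ (shortest v)))

      next-root : ∀ m (w : Walk m r) → m ℕ.≤ 0 → next m w ≡ r
      next-root zero w z≤n = refl

      dist-root : dist r ℕ.≤ 0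
      dist-root = proj₂ (proj₂ (shortest r)) 0 refl

      -- After the first step of a shortest walk the rest is shortest too: a shorter one from `u`,
      -- prefixed with the edge from `v`, would beat `m`.
      next-spec : ∀ {v} → v ≢ r → ∀ m (w : Walk m v) → (∀ j → Walk j v → m ℕ.≤ j) →
                  m ≡ suc (dist (next m w)) × Adj T v (next m w)
      next-spec v≢r zero    w           min = contradiction w v≢r
      next-spec v≢r (suc m) (u , a , w) min =
        cong suc (ℕₚ.≤-antisym
          (ℕₚ.≤-pred (min (suc (dist u)) (u , a , proj₁ (proj₂ (shortest u)))))
          (proj₂ (proj₂ (shortest u)) m w)) , a

      par-spec : ∀ {v} → v ≢ r → dist v ≡ suc (dist (par v)) × Adj T v (par v)
      par-spec {v} v≢r = next-spec v≢r (dist v) (proj₁ (proj₂ (shortest v))) (proj₂ (proj₂ (shortest v)))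

    rooting : Rooting T r
    rooting = record
      { parent      = par
      ; depth       = dist
      ; parent-root = next-root (dist r) _ dist-root
      ; depth-root  = ℕₚ.n≤0⇒n≡0 dist-root
      ; depth-suc   = λ v≢r → proj₁ (par-spec v≢r)
      ; adj-parent  = λ v≢r → proj₂ (par-spec v≢r)
      }

module TreeEdges {T : List (Edge n)} {r : Fin n} (R : Rooting T r) where
  open Rooting R

  data Anc (v : Fin n) : Fin n → Set where
    self : Anc v v
    up   : ∀ {u} → u ≢ r → Anc v (parent u) → Anc v u

  anc-depth : ∀ {v u} → Anc v u → depth v ℕ.≤ depth u
  anc-depth self       = ℕₚ.≤-refl
  anc-depth (up u≢r a) = ℕₚ.≤-trans (anc-depth a) (subst (depth _ ℕ.≤_) (sym (depth-suc u≢r)) (ℕₚ.n≤1+n _))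

  parent-depth< : ∀ {u} → u ≢ r → depth (parent u) ℕ.< depth u
  parent-depth< u≢r = ℕₚ.≤-reflexive (sym (depth-suc u≢r))

  ¬anc-parent : ∀ {u} → u ≢ r → ¬ Anc u (parent u)
  ¬anc-parent u≢r a = ℕₚ.<⇒≱ (parent-depth< u≢r) (anc-depth a)

  anc-≥depth : ∀ {v u} → Anc v u → depth u ℕ.≤ depth v → v ≡ u
  anc-≥depth self       _  = refl
  anc-≥depth (up u≢r a) le = contradiction (ℕₚ.≤-trans le (anc-depth a)) (ℕₚ.<⇒≱ (parent-depth< u≢r))

  depth>0⇒≢r : ∀ {u k} → k ℕ.< depth u → u ≢ r
  depth>0⇒≢r lt refl = contradiction (subst (_ ℕ.<_) depth-root lt) λ ()

  Closable : Fin n → List (Fin n) → Set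
  Closable z vs = Linked (Adj T) (vs ++ [ z ])

  depth≡0⇒≡r : ∀ {u} → depth u ≡ 0 → u ≡ r
  depth≡0⇒≡r {u} eq with u Finₚ.≟ r
  ... | yes u≡r = u≡r
  ... | no u≢r = contradiction (trans (sym eq) (depth-suc u≢r)) λ ()

  deeper⇒≢r : ∀ {i j} → i ≢ j → depth j ℕ.≤ depth i → i ≢ r
  deeper⇒≢r i≢j le refl = i≢j (sym (depth≡0⇒≡r (ℕₚ.n≤0⇒n≡0 (ℕₚ.≤-trans le (ℕₚ.≤-reflexive depth-root)))))

  -- The tree path from i to j, grown from both ends; ts is the part already known beyond j.
  joinPath : ∀ k z i j ts → depth i ℕ.+ depth j ℕ.≤ k →
             Unique (j ∷ ts) → Closable z (j ∷ ts) →
             All (λ v → ¬ Anc v i) ts → All (λ v → ¬ Anc v j) ts →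
             ∃[ vs ] ( Unique (i ∷ vs) × Closable z (i ∷ vs)
                     × All (λ v → (Anc v i ⊎ Anc v j) ⊎ v ∈ ts) (i ∷ vs)
                     × length ts ℕ.≤ length vs
                     × (i ≢ j → suc (length ts) ℕ.≤ length vs)
                     × (i ≢ j → parent i ≢ j → i ≢ parent j → suc (suc (length ts)) ℕ.≤ length vs))
  joinPath k z i j ts le uq ln ¬i ¬j with i Finₚ.≟ j
  ... | yes refl = ts , uq , ln , inj₁ (inj₁ self) ∷ All.tabulate inj₂ , ℕₚ.≤-refl
                 , (λ i≢i → contradiction refl i≢i) , (λ i≢i → contradiction refl i≢i)
  -- The deeper end climbs. Being no higher than the other end and different from it, it is not one
  -- of its ancestors, which keeps the path free of repetitions.
  ... | no i≢j with ℕₚ.≤-total (depth j) (depth i)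
  ...   | inj₁ j≤i = climbLeft k le
    where
    i≢r = deeper⇒≢r i≢j j≤i

    climbLeft : ∀ k → depth i ℕ.+ depth j ℕ.≤ k → _
    climbLeft zero    le′ = contradiction (ℕₚ.≤-trans (ℕₚ.≤-reflexive (sym (depth-suc i≢r))) (ℕₚ.m+n≤o⇒m≤o _ le′)) λ ()
    climbLeft (suc k) le′ with joinPath k z (parent i) j ts
           (ℕₚ.≤-pred (subst (λ m → m ℕ.+ depth j ℕ.≤ suc k) (depth-suc i≢r) le′)) uq ln
           (All.map (λ ¬a a → ¬a (up i≢r a)) ¬i) ¬j
    ... | vs , uq′ , ln′ , anc′ , l₀ , l₁ , l₂ =
      parent i ∷ vs
      , All.map fresh anc′ ∷ uq′
      , adj-parent i≢r ∷ ln′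
      , inj₁ (inj₁ self) ∷ All.map [ [ inj₁ ∘ inj₁ ∘ up i≢r , inj₁ ∘ inj₂ ]′ , inj₂ ]′ anc′
      , ℕₚ.m≤n⇒m≤1+n l₀
      , (λ _ → s≤s l₀)
      , (λ _ pi≢j _ → s≤s (l₁ pi≢j))
      where
      fresh : ∀ {v} → (Anc v (parent i) ⊎ Anc v j) ⊎ v ∈ ts → i ≢ v
      fresh (inj₁ (inj₁ a)) refl = ¬anc-parent i≢r a
      fresh (inj₁ (inj₂ a)) refl = i≢j (anc-≥depth a j≤i)
      fresh (inj₂ v∈ts)     refl = All.lookup ¬i v∈ts self
  ...   | inj₂ i≤j = climbRight k le
    where
    j≢r = deeper⇒≢r (i≢j ∘ sym) i≤j

    climbRight : ∀ k → depth i ℕ.+ depth j ℕ.≤ k → _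
    climbRight zero    le′ = contradiction (ℕₚ.≤-trans (ℕₚ.≤-reflexive (sym (depth-suc j≢r))) (ℕₚ.m+n≤o⇒n≤o (depth i) le′)) λ ()
    climbRight (suc k) le′ with joinPath k z i (parent j) (j ∷ ts)
           (ℕₚ.≤-pred (subst (ℕ._≤ suc k) (trans (cong (depth i ℕ.+_) (depth-suc j≢r)) (ℕₚ.+-suc _ _)) le′))
           (((λ pj≡j → ¬anc-parent j≢r (subst (λ u → Anc u (parent j)) pj≡j self))
              ∷ All.tabulate (λ v∈ts pj≡v → All.lookup ¬j v∈ts (subst (λ u → Anc u j) pj≡v (up j≢r self)))) ∷ uq)
           (swap (adj-parent j≢r) ∷ ln)
           ((λ a → i≢j (sym (anc-≥depth a i≤j))) ∷ ¬i)
           (¬anc-parent j≢r ∷ All.map (λ ¬a a → ¬a (up j≢r a)) ¬j)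
    ... | vs , uq′ , ln′ , anc′ , l₀ , l₁ , l₂ =
      vs , uq′ , ln′ , All.map relax anc′
      , ℕₚ.≤-trans (ℕₚ.n≤1+n _) l₀ , (λ _ → l₀) , (λ _ _ i≢pj → l₁ i≢pj)
      where
      relax : ∀ {v} → (Anc v i ⊎ Anc v (parent j)) ⊎ v ∈ j ∷ ts → (Anc v i ⊎ Anc v j) ⊎ v ∈ ts
      relax (inj₁ (inj₁ a))      = inj₁ (inj₁ a)
      relax (inj₁ (inj₂ a))      = inj₁ (inj₂ (up j≢r a))
      relax (inj₂ (here refl))   = inj₁ (inj₂ self)
      relax (inj₂ (there v∈ts)) = inj₂ v∈ts

  -- Otherwise the tree path from `i` to `j` has at least three vertices, and the edge closes it to
  -- a cycle.
  tree-edge : Acyclic T → ∀ {i j} → i ≢ j → Adj T i j → ParentOf i j ⊎ ParentOf j i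
  tree-edge acyc {i} {j} i≢j a with i Finₚ.≟ parent j | j Finₚ.≟ parent i
  ... | yes i≡pj | _ = inj₁ ((λ { refl → i≢j (trans i≡pj parent-root) }) , i≡pj)
  ... | no _ | yes j≡pi = inj₂ ((λ { refl → i≢j (sym (trans j≡pi parent-root)) }) , j≡pi)
  ... | no i≢pj | no j≢pi with joinPath _ i i j [] ℕₚ.≤-refl ([] ∷ []) (swap a ∷ [-]) [] []
  ...   | vs , uq , ln , _ , _ , _ , l₂ = ⊥-elim (acyc (i , vs , l₂ i≢j (j≢pi ∘ sym) i≢pj , uq , ln))

-- Root the tree at `zero` first: a deepest vertex has no child, so its parent is its only possible
-- neighbour.
leafRoot : {T : List (Edge (suc n))} → Connected T → Acyclic T → (∀ {i} → ¬ Adj T i i) →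
           ∃[ r ] (∀ {x y} → Adj T r x → Adj T r y → x ≡ y)
leafRoot {T = T} conn acyc loopless = r , λ a b → trans (only a) (sym (only b))
  where
  open Rooting (rooting T zero conn)
  open TreeEdges (rooting T zero conn)

  r = proj₁ (argmax depth)

  only : ∀ {x} → Adj T r x → x ≡ parent r
  only {x} a with tree-edge acyc (λ { refl → loopless a }) a
  ... | inj₂ (_ , x≡pr) = x≡pr
  ... | inj₁ (x≢z , r≡px) = contradiction (proj₂ (argmax depth) x)
      (ℕₚ.<⇒≱ (subst (λ u → depth u ℕ.< depth x) (sym r≡px) (parent-depth< x≢z)))

-- Random cuts

mean : (Vec Bool m → ℚ) → ℚ
mean {zero}  f = f []
mean {suc m} f = ½ * (mean (f ∘ (false ∷_)) + mean (f ∘ (true ∷_)))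

mean-cong : {f g : Vec Bool m → ℚ} → (∀ v → f v ≡ g v) → mean f ≡ mean g
mean-cong {zero}  eq = eq []
mean-cong {suc m} eq = cong₂ (λ x y → ½ * (x + y)) (mean-cong (eq ∘ (false ∷_))) (mean-cong (eq ∘ (true ∷_)))

mean-+ : (f g : Vec Bool m → ℚ) → mean (λ v → f v + g v) ≡ mean f + mean g
mean-+ {zero}  f g = refl
mean-+ {suc m} f g = trans
  (cong₂ (λ x y → ½ * (x + y)) (mean-+ (f ∘ (false ∷_)) (g ∘ (false ∷_))) (mean-+ (f ∘ (true ∷_)) (g ∘ (true ∷_))))
  (solve 5 (λ h a b c d → h :* ((a :+ b) :+ (c :+ d)) := h :* (a :+ c) :+ h :* (b :+ d)) refl
     ½ (mean (f ∘ (false ∷_))) (mean (g ∘ (false ∷_))) (mean (f ∘ (true ∷_))) (mean (g ∘ (true ∷_))))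

half-double : ∀ x → ½ * (x + x) ≡ x
half-double x = trans (solve 2 (λ h y → h :* (y :+ y) := (h :+ h) :* y) refl ½ x) (ℚₚ.*-identityˡ x)

mean-const : (x : ℚ) → mean {m} (λ _ → x) ≡ x
mean-const {zero}  x = refl
mean-const {suc m} x = trans (cong (λ y → ½ * (y + y)) (mean-const {m} x)) (half-double x)

mean-flip : (f : Vec Bool m → ℚ) (i : Fin m) → mean (λ v → f (v [ i ]%= not)) ≡ mean f
mean-flip f zero    = cong (½ *_) (ℚₚ.+-comm (mean (f ∘ (true ∷_))) (mean (f ∘ (false ∷_))))
mean-flip f (suc i) = cong₂ (λ x y → ½ * (x + y)) (mean-flip (f ∘ (false ∷_)) i) (mean-flip (f ∘ (true ∷_)) i)

attained : (f : Vec Bool m → ℚ) → ∃[ v ] (mean f ≤ f v)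
attained {zero}  f = [] , ℚₚ.≤-refl
attained {suc m} f with attained (f ∘ (false ∷_)) | attained (f ∘ (true ∷_))
... | u , p | v , q with ℚₚ.≤-total (f (false ∷ u)) (f (true ∷ v))
...   | inj₁ le = true ∷ v , ℚₚ.≤-trans (ℚₚ.*-monoˡ-≤-nonNeg ½ (ℚₚ.+-mono-≤ (ℚₚ.≤-trans p le) q)) (ℚₚ.≤-reflexive (half-double _))
...   | inj₂ ge = false ∷ u , ℚₚ.≤-trans (ℚₚ.*-monoˡ-≤-nonNeg ½ (ℚₚ.+-mono-≤ p (ℚₚ.≤-trans q ge))) (ℚₚ.≤-reflexive (half-double _))

Key : ℕ → Set
Key m = Fin m × Bool

-- Twice the probability that two keys get different values under uniform independent bits.
score : Key m → Key m → ℕ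
score (i , b) (j , b′) with i Finₚ.≟ j
... | no _  = 1
... | yes _ = if b ⊕ b′ then 2 else 0

halves : ℕ → ℚ
halves zero    = 0ℚ
halves (suc k) = ½ + halves k

value : Vec Bool m → Key m → Bool
value ε (i , b) = b ⊕ Vec.lookup ε i

term : ℚ → Bool → ℚ
term x s = if s then x else 0ℚ

term-not : ∀ x s → term x s + term x (not s) ≡ x
term-not x true  = ℚₚ.+-identityʳ x
term-not x false = ℚₚ.+-identityˡ x

⊕-cancel : ∀ a b c → (a ⊕ c) ⊕ (b ⊕ c) ≡ a ⊕ b
⊕-cancel true  true  true  = refl
⊕-cancel true  true  false = refl
⊕-cancel true  false true  = refl
⊕-cancel true  false false = refl
⊕-cancel false true  true  = refl
⊕-cancel false true  false = refl
⊕-cancel false false true  = refl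
⊕-cancel false false false = refl

⊕-notˡ : ∀ a c x → (a ⊕ not c) ⊕ x ≡ not ((a ⊕ c) ⊕ x)
⊕-notˡ true  true  x = refl
⊕-notˡ true  false x = sym (Boolₚ.not-involutive x)
⊕-notˡ false true  x = sym (Boolₚ.not-involutive x)
⊕-notˡ false false x = refl

-- A common bit cancels. If the bits differ, flipping the first one exchanges cut and uncut, so the
-- outcomes pair up and each pair contributes `x` once.
mean-term : ∀ x (k l : Key m) → mean (λ ε → term x (value ε k ⊕ value ε l)) ≡ x * halves (score k l)
mean-term {m} x (i , b) (j , b′) with i Finₚ.≟ j
... | yes refl = trans (mean-cong λ ε → cong (term x) (⊕-cancel b b′ (Vec.lookup ε i)))
                       (trans (mean-const {m} _) (const (b ⊕ b′)))
  where
  const : ∀ s → term x s ≡ x * halves (if s then 2 else 0)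
  const true  = sym (ℚₚ.*-identityʳ x)
  const false = sym (ℚₚ.*-zeroʳ x)
... | no i≢j = begin
  mean f                                   ≡⟨ sym (half-double _) ⟩
  ½ * (mean f + mean f)                    ≡⟨ cong (λ y → ½ * (mean f + y)) (sym (mean-flip f i)) ⟩
  ½ * (mean f + mean (λ ε → f (flip ε)))   ≡⟨ cong (½ *_) (sym (mean-+ f (f ∘ flip))) ⟩
  ½ * mean (λ ε → f ε + f (flip ε))        ≡⟨ cong (½ *_) (mean-cong balanced) ⟩
  ½ * mean {m} (λ _ → x)                   ≡⟨ cong (½ *_) (mean-const {m} x) ⟩
  ½ * x                                    ≡⟨ ℚₚ.*-comm ½ x ⟩
  x * ½                                    ∎
  where
  open ≡-Reasoning
  f : Vec Bool m → ℚ
  f ε = term x (value ε (i , b) ⊕ value ε (j , b′))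
  flip : Vec Bool m → Vec Bool m
  flip ε = ε [ i ]%= not
  flipped : ∀ ε → value (flip ε) (i , b) ⊕ value (flip ε) (j , b′) ≡ not (value ε (i , b) ⊕ value ε (j , b′))
  flipped ε = trans
    (cong₂ (λ s t → (b ⊕ s) ⊕ (b′ ⊕ t)) (Vecₚ.lookup∘updateAt i ε) (Vecₚ.lookup∘updateAt′ j i (i≢j ∘ sym) ε))
    (⊕-notˡ b (Vec.lookup ε i) _)
  balanced : ∀ ε → f ε + f (flip ε) ≡ x
  balanced ε = trans (cong (λ s → f ε + term x s) (flipped ε)) (term-not x (value ε (i , b) ⊕ value ε (j , b′)))

weighted : Weight n → List (Edge n) → (Fin n → Fin n → ℚ) → ℚ
weighted w []            q = 0ℚ
weighted w ((i , j) ∷ E) q = w i j * q i j + weighted w E q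

goodCut : (w : Weight n) (E : List (Edge n)) (key : Fin n → Key m) →
          ∃[ S ] (weighted w E (λ i j → halves (score (key i) (key j))) ≤ cutWeight w E S)
goodCut {n} {m} w E key with attained (λ ε → cutWeight w E (λ v → value ε (key v)))
... | ε , le = (λ v → value ε (key v)) , ℚₚ.≤-trans (ℚₚ.≤-reflexive (sym (expected E))) le
  where
  expected : ∀ E → mean (λ ε → cutWeight w E (λ v → value ε (key v)))
                   ≡ weighted w E (λ i j → halves (score (key i) (key j)))
  expected []            = mean-const {m} 0ℚ
  expected ((i , j) ∷ E) = trans
    (mean-+ (λ ε → term (w i j) (value ε (key i) ⊕ value ε (key j))) _)
    (cong₂ _+_ (mean-term (w i j) (key i) (key j)) (expected E))

-- The three classes of cuts

Colour : Set
Colour = Fin 3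

third : Colour → Colour → Colour
third zero       (suc zero)       = # 2
third zero       (suc (suc zero)) = # 1
third (suc zero) zero             = # 2
third (suc zero) (suc (suc zero)) = # 0
third (suc (suc zero)) zero       = # 1
third (suc (suc zero)) (suc zero) = # 0
third a          _                = a

third-≢ˡ : ∀ a b → a ≢ b → third a b ≢ a
third-≢ˡ = from-yes (all? λ a → all? λ b → ¬? (a ≟ b) →-dec ¬? (third a b ≟ a))

third-≢ʳ : ∀ a b → a ≢ b → third a b ≢ b
third-≢ʳ = from-yes (all? λ a → all? λ b → ¬? (a ≟ b) →-dec ¬? (third a b ≟ b))

third-unique : ∀ a b c → a ≢ b → c ≢ a → c ≢ b → c ≡ third a b
third-unique = from-yes (all? λ a → all? λ b → all? λ c →
  ¬? (a ≟ b) →-dec (¬? (c ≟ a) →-dec (¬? (c ≟ b) →-dec (c ≟ third a b))))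

-- Scores are twice probabilities, so this is six times the average probability over the three
-- classes: 3 stands for 1/2 and 5 for 5/6.
total : (Colour → ℕ) → ℕ
total q = q (# 0) ℕ.+ (q (# 1) ℕ.+ q (# 2))

-- Class `α` may contribute 0, which class `γ` makes up for: 0 + 2 + 1.
total-compensated : ∀ (q : Colour → ℕ) α γ → γ ≢ α → (∀ c → c ≢ α → 1 ℕ.≤ q c) → 2 ℕ.≤ q γ → 3 ℕ.≤ total q
total-compensated q zero zero n g h = contradiction refl n
total-compensated q zero (suc zero) n g h = ℕₚ.+-mono-≤ (z≤n {q (# 0)}) (ℕₚ.+-mono-≤ h (g (# 2) λ ()))
total-compensated q zero (suc (suc zero)) n g h = ℕₚ.+-mono-≤ (z≤n {q (# 0)}) (ℕₚ.+-mono-≤ (g (# 1) λ ()) h)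
total-compensated q (suc zero) zero n g h = ℕₚ.+-mono-≤ h (ℕₚ.+-mono-≤ (z≤n {q (# 1)}) (g (# 2) λ ()))
total-compensated q (suc zero) (suc zero) n g h = contradiction refl n
total-compensated q (suc zero) (suc (suc zero)) n g h = ℕₚ.+-mono-≤ (g (# 0) λ ()) (ℕₚ.+-mono-≤ (z≤n {q (# 1)}) h)
total-compensated q (suc (suc zero)) zero n g h = ℕₚ.+-mono-≤ h (ℕₚ.+-mono-≤ (g (# 1) λ ()) (z≤n {q (# 2)}))
total-compensated q (suc (suc zero)) (suc zero) n g h = ℕₚ.+-mono-≤ (g (# 0) λ ()) (ℕₚ.+-mono-≤ h (z≤n {q (# 2)}))
total-compensated q (suc (suc zero)) (suc (suc zero)) n g h = contradiction refl n

total-tree : ∀ (q : Colour → ℕ) γ → (∀ c → c ≢ γ → 2 ℕ.≤ q c) → 1 ℕ.≤ q γ → 5 ℕ.≤ total q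
total-tree q zero             g h = ℕₚ.+-mono-≤ h (ℕₚ.+-mono-≤ (g (# 1) λ ()) (g (# 2) λ ()))
total-tree q (suc zero)       g h = ℕₚ.+-mono-≤ (g (# 0) λ ()) (ℕₚ.+-mono-≤ h (g (# 2) λ ()))
total-tree q (suc (suc zero)) g h = ℕₚ.+-mono-≤ (g (# 0) λ ()) (ℕₚ.+-mono-≤ (g (# 1) λ ()) h)

parity : ℕ → Bool
parity zero    = false
parity (suc k) = not (parity k)

not-≢ : ∀ b → not b ≢ b
not-≢ true  ()
not-≢ false ()

⊕-injectiveʳ : ∀ a {b c} → b ≢ c → a ⊕ b ≢ a ⊕ c
⊕-injectiveʳ true  b≢c eq = b≢c (Boolₚ.not-injective eq)
⊕-injectiveʳ false b≢c eq = b≢c eq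

⊕-injectiveˡ : ∀ {a b} c → a ≢ b → a ⊕ c ≢ b ⊕ c
⊕-injectiveˡ {a} {b} c a≢b eq = ⊕-injectiveʳ c a≢b (trans (Boolₚ.xor-comm c a) (trans eq (Boolₚ.xor-comm b c)))

module FoldUp {T : List (Edge n)} {r : Fin n} (R : Rooting T r) where
  open Rooting R

  up-induction : (P : Fin n → Set) → P r → (∀ v → v ≢ r → P (parent v) → P v) → ∀ v → P v
  up-induction P base ascend v = go (depth v) v refl
    where
    open TreeEdges R using (depth≡0⇒≡r; depth>0⇒≢r)
    go : ∀ k v → depth v ≡ k → P v
    go zero    v eq = subst P (sym (depth≡0⇒≡r eq)) base
    go (suc k) v eq = ascend v v≢r (go k (parent v) (ℕₚ.suc-injective (trans (sym (depth-suc v≢r)) eq)))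
      where v≢r = depth>0⇒≢r (subst (0 ℕ.<_) (sym eq) (s≤s z≤n))

  -- The recursion runs on the depth, as `parent v` is not structurally smaller than `v`; outside,
  -- `foldUp` is known only through its two equations.
  module _ {X : Set} (base : X) (ascend : Fin n → X → X) where
    private
      go : ℕ → Fin n → X
      go zero    v = base
      go (suc k) v = ascend v (go k (parent v))

    abstract
      foldUp : Fin n → X
      foldUp v = go (depth v) v

      foldUp-root : foldUp r ≡ base
      foldUp-root = cong (λ k → go k r) depth-root

      foldUp-step : ∀ {v} → v ≢ r → foldUp v ≡ ascend v (foldUp (parent v))
      foldUp-step {v} v≢r = cong (λ k → go k v) (depth-suc v≢r)

module Labelling
  {n} (A : Fin n → Fin n → Set) (A? : ∀ u v → Dec (A u v))
  (A-sym : ∀ {u v} → A u v → A v u)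
  (triangleFree : ∀ {a b c} → A a b → A b c → A a c → ⊥)
  (subcubic : ∀ {v a b c e} → A v a → A v b → A v c → A v e →
              a ≢ b → a ≢ c → a ≢ e → b ≢ c → b ≢ e → c ≢ e → ⊥)
  {T : List (Edge n)} {r : Fin n} (R : Rooting T r)
  (T⊆A : ∀ {u v} → Adj T u v → A u v)
  (leafRooted : ∀ {x y} → Adj T r x → Adj T r y → x ≡ y)
  where

  open Rooting R
  open TreeEdges R
  open FoldUp R

  private
    V = Fin n
    p : V → V
    p = parent
    d : V → ℕ
    d = depth

  A-parent : ∀ {v} → v ≢ r → A v (p v)
  A-parent = T⊆A ∘ adj-parent

  loopless : ∀ {v} → ¬ A v v
  loopless a = triangleFree a a a

  -- Cousins, turned vertices and the colouring of the tree edges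

  Leaf : V → Set
  Leaf s = ∀ y → y ≢ r → p y ≢ s

  abstract
    leaf? : ∀ s → Dec (Leaf s)
    leaf? s = all? λ y → ¬? (y ≟ r) →-dec ¬? (p y ≟ s)

  Cousins : V → V → Set
  Cousins u v = d u ≡ d v × p (p u) ≡ p (p v) × p u ≢ p v

  cousins-sym : ∀ {u v} → Cousins u v → Cousins v u
  cousins-sym (a , b , c) = sym a , sym b , c ∘ sym

  -- The order on vertices only serves to turn exactly one end of a cousin edge between two inner vertices.
  Turned : V → Set
  Turned v = ¬ Leaf v × ∃[ w ] (A v w × Cousins v w × (Leaf w ⊎ v < w))

  abstract
    turned? : ∀ v → Dec (Turned v)
    turned? v = ¬? (leaf? v) ×-dec any? λ w →
      A? v w ×-dec (((d v ℕₚ.≟ d w) ×-dec ((p (p v) ≟ p (p w)) ×-dec ¬? (p v ≟ p w)))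
      ×-dec (leaf? w ⊎-dec (v <? w)))

  -- The colour of the edge above a vertex, paired with the colour of the edge above its parent.
  nextColours : V → Colour × Colour → Colour × Colour
  nextColours v (a , b) = (if does (turned? v) then b else third a b) , a

  -- No edge lies above the root; the fictitious pair 0, 2 makes the default colour equal to the
  -- depth modulo 3.
  colours : V → Colour × Colour
  colours = foldUp (# 0 , # 2) nextColours

  colour : V → Colour
  colour = proj₁ ∘ colours

  private
    colours-step = foldUp-step (# 0 , # 2) nextColours

  colour-above : ∀ {v} → v ≢ r → proj₂ (colours v) ≡ colour (p v)
  colour-above v≢r = cong proj₂ (colours-step v≢r)

  colour-turned : ∀ {v} → v ≢ r → Turned v → colour v ≡ proj₂ (colours (p v))
  colour-turned {v} v≢r t = trans (cong proj₁ (colours-step v≢r))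
    (cong (λ s → if s then proj₂ (colours (p v)) else third (colour (p v)) (proj₂ (colours (p v)))) (dec-true (turned? v) t))

  colour-unturned : ∀ {v} → v ≢ r → ¬ Turned v → colour v ≡ third (colour (p v)) (proj₂ (colours (p v)))
  colour-unturned {v} v≢r t = trans (cong proj₁ (colours-step v≢r))
    (cong (λ s → if s then proj₂ (colours (p v)) else third (colour (p v)) (proj₂ (colours (p v)))) (dec-false (turned? v) t))

  -- A turned vertex swaps the pair of its parent and an unturned one puts the third colour in
  -- front; both rules keep the two entries distinct.
  colours-distinct : ∀ v → colour v ≢ proj₂ (colours v)
  colours-distinct = up-induction _
    (λ eq → contradiction (trans (sym (cong proj₁ root)) (trans eq (cong proj₂ root))) λ ())
    λ v v≢r ih eq → ascend v v≢r ih (trans eq (colour-above v≢r))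
    where
    root = foldUp-root (# 0 , # 2) nextColours
    ascend : ∀ v → v ≢ r → colour (p v) ≢ proj₂ (colours (p v)) → colour v ≢ colour (p v)
    ascend v v≢r ih eq with turned? v
    ... | yes t = ih (trans (sym eq) (colour-turned v≢r t))
    ... | no ¬t = third-≢ˡ _ _ ih (trans (sym (colour-unturned v≢r ¬t)) eq)

  colour≢parent : ∀ {v} → v ≢ r → colour v ≢ colour (p v)
  colour≢parent v≢r eq = colours-distinct _ (trans eq (sym (colour-above v≢r)))

  colour-turned² : ∀ {v} → v ≢ r → p v ≢ r → Turned v → colour v ≡ colour (p (p v))
  colour-turned² v≢r pv≢r t = trans (colour-turned v≢r t) (colour-above pv≢r)

  colour-unturned² : ∀ {v} → v ≢ r → p v ≢ r → ¬ Turned v → colour v ≡ third (colour (p v)) (colour (p (p v)))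
  colour-unturned² {v} v≢r pv≢r t = trans (colour-unturned v≢r t) (cong (third (colour (p v))) (colour-above pv≢r))

  colour≢grandparent : ∀ {v} → v ≢ r → p v ≢ r → ¬ Turned v → colour v ≢ colour (p (p v))
  colour≢grandparent v≢r pv≢r t eq = third-≢ʳ _ _ (colour≢parent pv≢r) (trans (sym (colour-unturned² v≢r pv≢r t)) eq)

  -- Deleting the tree edges of colour c leaves subtrees; top c v is the highest vertex of the one containing v.
  top : Colour → V → V
  top c = foldUp r λ v z → if does (colour v ≟ c) then v else z

  top-root : ∀ c → top c r ≡ r
  top-root c = foldUp-root r _

  top-here : ∀ {c v} → v ≢ r → colour v ≡ c → top c v ≡ v
  top-here {c} {v} v≢r eq = trans (foldUp-step r _ v≢r)
    (cong (λ s → if s then v else top c (p v)) (dec-true (colour v ≟ c) eq))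

  top-up : ∀ {c v} → v ≢ r → colour v ≢ c → top c v ≡ top c (p v)
  top-up {c} {v} v≢r neq = trans (foldUp-step r _ v≢r)
    (cong (λ s → if s then v else top c (p v)) (dec-false (colour v ≟ c) neq))

  top-depth : ∀ c v → d (top c v) ℕ.≤ d v
  top-depth c = up-induction _ (ℕₚ.≤-reflexive (cong d (top-root c))) ascend
    where
    ascend : ∀ v → v ≢ r → d (top c (p v)) ℕ.≤ d (p v) → d (top c v) ℕ.≤ d v
    ascend v v≢r ih with colour v ≟ c
    ... | yes eq = ℕₚ.≤-reflexive (cong d (top-here v≢r eq))
    ... | no neq = ℕₚ.≤-trans (ℕₚ.≤-reflexive (cong d (top-up v≢r neq)))
                     (ℕₚ.≤-trans ih (ℕₚ.<⇒≤ (parent-depth< v≢r)))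

  top-self-colour : ∀ {c v} → v ≢ r → top c v ≡ v → colour v ≡ c
  top-self-colour {c} {v} v≢r eq with colour v ≟ c
  ... | yes e = e
  ... | no neq = contradiction (subst (λ u → d u ℕ.≤ d (p v)) (trans (sym (top-up v≢r neq)) eq) (top-depth c (p v)))
                   (ℕₚ.<⇒≱ (parent-depth< v≢r))

  -- Locates `u` below its top: if all children of the top are leaves, `u` must be the top or one of
  -- these children.
  top-child : ∀ c u → top c u ≡ u ⊎ ∃[ y ] (y ≢ r × p y ≡ top c u × (u ≡ y ⊎ ¬ Leaf y))
  top-child c = up-induction _ (inj₁ (top-root c)) ascend
    where
    ascend : ∀ v → v ≢ r → _ → _
    ascend v v≢r ih with colour v ≟ c
    ... | yes eq = inj₁ (top-here v≢r eq)
    ... | no neq with ih | top-up v≢r neq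
    ...   | inj₁ t                             | e = inj₂ (v , v≢r , sym (trans e t) , inj₁ refl)
    ...   | inj₂ (y , y≢r , py≡ , inj₁ pv≡y)   | e = inj₂ (y , y≢r , trans py≡ (sym e) , inj₂ λ leaf → leaf v v≢r pv≡y)
    ...   | inj₂ (y , y≢r , py≡ , inj₂ ¬leaf)  | e = inj₂ (y , y≢r , trans py≡ (sym e) , inj₂ ¬leaf)

  data Near (z : V) : V → Set where
    at₀ : Near z z
    at₁ : ∀ {u} → u ≢ r → p u ≡ z → Near z u
    at₂ : ∀ {u} → u ≢ r → p u ≢ r → p (p u) ≡ z → Near z u

  -- Above an unturned vertex three consecutive edges have distinct colours.
  top-near : ∀ c {u} → ¬ Turned u → Near (top c u) u
  top-near c {u} ¬t with u ≟ r
  ... | yes refl = subst (λ z → Near z r) (sym (top-root c)) at₀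
  ... | no u≢r with colour u ≟ c
  ...   | yes e₀ = subst (λ z → Near z u) (sym (top-here u≢r e₀)) at₀
  ...   | no n₀ with p u ≟ r
  ...     | yes pu≡r = at₁ u≢r (sym (trans (top-up u≢r n₀) (trans (cong (top c) pu≡r) (trans (top-root c) (sym pu≡r)))))
  ...     | no pu≢r with colour (p u) ≟ c
  ...       | yes e₁ = at₁ u≢r (sym (trans (top-up u≢r n₀) (top-here pu≢r e₁)))
  ...       | no n₁ = at₂ u≢r pu≢r (sym (trans (top-up u≢r n₀) (trans (top-up pu≢r n₁) top²)))
    where
    top² : top c (p (p u)) ≡ p (p u)
    top² with p (p u) ≟ r
    ... | yes eq = trans (cong (top c) eq) (trans (top-root c) (sym eq))
    ... | no ppu≢r with colour (p (p u)) ≟ c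
    ...   | yes e₂ = top-here ppu≢r e₂
    ...   | no n₂ = contradiction (trans (colour-unturned² u≢r pu≢r ¬t) (sym (third-unique _ _ c (colour≢parent pu≢r) (n₁ ∘ sym) (n₂ ∘ sym)))) n₀

  -- Depths of cousins and degrees of turned vertices

  cousins⇒≢r : ∀ {u v} → Cousins u v → u ≢ r
  cousins⇒≢r (d≡ , _ , pu≢pv) refl = pu≢pv (cong p (sym (depth≡0⇒≡r (trans (sym d≡) depth-root))))

  cousins⇒parent-depth : ∀ {u v} → Cousins u v → d (p u) ≡ d (p v)
  cousins⇒parent-depth cs@(d≡ , _) = ℕₚ.suc-injective
    (trans (sym (depth-suc (cousins⇒≢r cs))) (trans d≡ (depth-suc (cousins⇒≢r (cousins-sym cs)))))

  cousins⇒parent≢r : ∀ {u v} → Cousins u v → p u ≢ r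
  cousins⇒parent≢r cs@(_ , _ , pu≢pv) pu≡r = pu≢pv (trans pu≡r (sym (depth≡0⇒≡r
    (trans (sym (cousins⇒parent-depth cs)) (trans (cong d pu≡r) depth-root)))))

  child : ∀ {v} → ¬ Leaf v → ∃[ y ] (y ≢ r × p y ≡ v)
  child {v} ¬leaf with any? (λ y → ¬? (y ≟ r) ×-dec (p y ≟ v))
  ... | yes found = found
  ... | no none   = contradiction (λ y y≢r py≡v → none (y , y≢r , py≡v)) ¬leaf

  turned⇒≢r : ∀ {v} → Turned v → v ≢ r
  turned⇒≢r (_ , _ , _ , cs , _) = cousins⇒≢r cs

  depth<⇒≢ : ∀ {u v} → d u ℕ.< d v → u ≢ v
  depth<⇒≢ lt refl = ℕₚ.<-irrefl refl lt

  depth-child : ∀ {y v} → y ≢ r → p y ≡ v → d y ≡ suc (d v)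
  depth-child y≢r refl = depth-suc y≢r

  parent≢child : ∀ {v y} → v ≢ r → y ≢ r → p y ≡ v → p v ≢ y
  parent≢child v≢r y≢r py≡v = depth<⇒≢ (ℕₚ.<-trans (parent-depth< v≢r)
    (ℕₚ.≤-reflexive (sym (depth-child y≢r py≡v))))

  A-child : ∀ {v y} → y ≢ r → p y ≡ v → A v y
  A-child y≢r refl = A-sym (A-parent y≢r)

  siblings-nonadjacent : ∀ {u v} → u ≢ r → v ≢ r → p u ≡ p v → ¬ A u v
  siblings-nonadjacent u≢r v≢r eq a = triangleFree (A-parent u≢r) (subst (λ z → A z _) (sym eq) (A-sym (A-parent v≢r))) a

  NonTree : V → V → Set
  NonTree u v = A u v × ¬ ParentOf u v × ¬ ParentOf v u

  nonTree-sym : ∀ {u v} → NonTree u v → NonTree v u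
  nonTree-sym (a , b , c) = A-sym a , c , b

  -- The parent, a child and the cousin `x` have different depths and already exhaust degree 3, so
  -- `x` is the only candidate for `w`.
  turned-neighbour : ∀ {v w} → Turned v → NonTree v w → Cousins v w × (Leaf w ⊎ v < w)
  turned-neighbour {v} {w} (¬leaf , x , vx , cs , ord) (vw , ¬vpw , ¬wpv) with w ≟ x
  ... | yes refl = cs , ord
  ... | no w≢x with child ¬leaf
  ...   | y , y≢r , py≡v = ⊥-elim (subcubic (A-parent v≢r) (A-child y≢r py≡v) vx vw
            (parent≢child v≢r y≢r py≡v)
            (depth<⇒≢ (subst (d (p v) ℕ.<_) (proj₁ cs) (parent-depth< v≢r)))
            (λ pv≡w → ¬wpv (v≢r , sym pv≡w))
            (depth<⇒≢ (subst (ℕ._< d y) (proj₁ cs) (ℕₚ.≤-reflexive (sym (depth-child y≢r py≡v)))) ∘ sym)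
            (λ { refl → ¬vpw (y≢r , sym py≡v) })
            (w≢x ∘ sym))
    where v≢r = cousins⇒≢r cs

  -- Besides the parent, one child and the cousin, a second child would be a fourth neighbour.
  turned-child-unique : ∀ {v y z} → Turned v → y ≢ r → p y ≡ v → z ≢ r → p z ≡ v → y ≡ z
  turned-child-unique {v} {y} {z} (_ , x , vx , cs , _) y≢r py≡v z≢r pz≡v with y ≟ z
  ... | yes eq = eq
  ... | no y≢z = ⊥-elim (subcubic (A-parent v≢r) (A-child y≢r py≡v) vx (A-child z≢r pz≡v)
            (parent≢child v≢r y≢r py≡v)
            (depth<⇒≢ (subst (d (p v) ℕ.<_) (proj₁ cs) (parent-depth< v≢r)))
            (parent≢child v≢r z≢r pz≡v)
            (x≢child y≢r py≡v ∘ sym)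
            y≢z
            (x≢child z≢r pz≡v))
    where
    v≢r = cousins⇒≢r cs
    x≢child : ∀ {y} → y ≢ r → p y ≡ v → x ≢ y
    x≢child {y} y≢r py≡v = depth<⇒≢ (subst (ℕ._< d y) (proj₁ cs) (ℕₚ.≤-reflexive (sym (depth-child y≢r py≡v))))

  -- Siblings, ties between subtrees and keys

  Second : V → Set
  Second q = ∃[ y ] (y ≢ r × p y ≡ p q × y < q)

  abstract
    second? : ∀ q → Dec (Second q)
    second? q = any? λ y → ¬? (y ≟ r) ×-dec ((p y ≟ p q) ×-dec (y <? q))

  -- The parent would be a fourth neighbour; the root, which has no parent, has at most one child by
  -- `leafRooted`.
  no-three-children : ∀ {l a b c} → a ≢ r → b ≢ r → c ≢ r → p a ≡ l → p b ≡ l → p c ≡ l →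
                      a ≢ b → a ≢ c → b ≢ c → ⊥
  no-three-children {l} {a} {b} a≢r b≢r c≢r pa pb pc a≢b a≢c b≢c with l ≟ r
  ... | yes refl = a≢b (leafRooted (below a≢r pa) (below b≢r pb))
    where
    below : ∀ {y} → y ≢ r → p y ≡ r → Adj T r y
    below y≢r py≡r = subst (λ z → Adj T z _) py≡r (swap (adj-parent y≢r))
  ... | no l≢r = subcubic (A-parent l≢r) (A-child a≢r pa) (A-child b≢r pb) (A-child c≢r pc)
    (parent≢child l≢r a≢r pa) (parent≢child l≢r b≢r pb) (parent≢child l≢r c≢r pc) a≢b a≢c b≢c

  first-child : ∀ {a b} → a ≢ r → b ≢ r → p a ≡ p b → a < b → does (second? a) ≡ false
  first-child a≢r b≢r eq lt = dec-false (second? _) λ { (y , y≢r , py , y<a) →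
    no-three-children y≢r a≢r b≢r py refl (sym eq) (Finₚ.<⇒≢ y<a) (Finₚ.<⇒≢ (Finₚ.<-trans y<a lt)) (Finₚ.<⇒≢ lt) }

  -- As no vertex has three children, the order of the vertices splits two siblings into a first and
  -- a second one. This provides the opposite signs.
  second-differs : ∀ {q q′} → q ≢ r → q′ ≢ r → p q ≡ p q′ → q ≢ q′ → does (second? q) ≢ does (second? q′)
  second-differs {q} {q′} q≢r q′≢r eq q≢q′ with <-cmp q q′
  ... | tri≈ _ q≡q′ _ = contradiction q≡q′ q≢q′
  ... | tri< lt _ _ = λ e → contradiction (trans (sym (first-child q≢r q′≢r eq lt)) (trans e (dec-true (second? q′) (q , q≢r , eq , lt)))) λ ()
  ... | tri> _ _ gt = λ e → contradiction (trans (sym (dec-true (second? q) (q′ , q′≢r , sym eq , gt))) (trans e (first-child q′≢r q≢r (sym eq) gt))) λ ()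

  -- In both cases `q` is the parent of the leaves concerned and `p q` their grandparent, where they
  -- meet their cousins: the leaf is `s` itself, or the leaves are the children of the turned `s`.
  data Tie (s : V) : V → Set where
    leafTie   : Leaf s → s ≢ r → p s ≢ r → Tie s (p s)
    turnedTie : Turned s → (∀ y → y ≢ r → p y ≡ s → Leaf y) → Tie s s

  Low Pendant : V → Set
  Low     s = Leaf s × s ≢ r × p s ≢ r
  Pendant s = Turned s × (∀ y → y ≢ r → p y ≡ s → Leaf y)

  abstract
    low? : ∀ s → Dec (Low s)
    low? s = leaf? s ×-dec (¬? (s ≟ r) ×-dec ¬? (p s ≟ r))

  abstract
    pendant? : ∀ s → Dec (Pendant s)
    pendant? s = turned? s ×-dec all? λ y → ¬? (y ≟ r) →-dec ((p y ≟ s) →-dec leaf? y)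

  choose : ∀ {s} → Dec (Low s) → Dec (Pendant s) → Maybe V
  choose {s} (yes _) _       = just (p s)
  choose {s} (no _)  (yes _) = just s
  choose {s} (no _)  (no _)  = nothing

  -- Subtrees topped by a low or pendant vertex share one random bit when they hang from the same vertex,
  -- with opposite signs on the two sides; tie s is the child on whose side s lies.
  tie : V → Maybe V
  tie s = choose (low? s) (pendant? s)

  tie-sound : ∀ {s q} → tie s ≡ just q → Tie s q
  tie-sound {s} = sound (low? s) (pendant? s)
    where
    sound : ∀ (x : Dec (Low s)) (y : Dec (Pendant s)) {q} → choose x y ≡ just q → Tie s q
    sound (yes (leaf , s≢r , ps≢r)) _                       refl = leafTie leaf s≢r ps≢r
    sound (no _)                    (yes (turned , leaves)) refl = turnedTie turned leaves

  tie-leaf : ∀ {s} → Leaf s → s ≢ r → p s ≢ r → tie s ≡ just (p s)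
  tie-leaf {s} leaf s≢r ps≢r with low? s
  ... | yes _   = refl
  ... | no ¬low = contradiction (leaf , s≢r , ps≢r) ¬low

  tie-pendant : ∀ {s} → Turned s → (∀ y → y ≢ r → p y ≡ s → Leaf y) → tie s ≡ just s
  tie-pendant {s} turned leaves with low? s | pendant? s
  ... | yes low | _          = contradiction (proj₁ low) (proj₁ turned)
  ... | no _    | yes _      = refl
  ... | no _    | no ¬pend   = contradiction (turned , leaves) ¬pend

  -- Two copies of the vertices index the bits, so that a tied and an untied subtree never share
  -- one.
  label : V → Maybe V → V ⊎ V
  label s nothing  = inj₁ s
  label s (just q) = inj₂ (p q)

  sign : Maybe V → Bool
  sign nothing  = false
  sign (just q) = does (second? q)

  key : Colour → V → Key (n ℕ.+ n)
  key c v = join n n (label (top c v) (tie (top c v))) , parity (d v) ⊕ sign (tie (top c v))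

  -- `Good` means that the edge is cut with probability at least 1/2, `Cut` that it is always cut.
  Good Cut : (u v : V) → Colour → Set
  Good u v c = proj₁ (key c u) ≡ proj₁ (key c v) → proj₂ (key c u) ≢ proj₂ (key c v)
  Cut  u v c = proj₁ (key c u) ≡ proj₁ (key c v) × proj₂ (key c u) ≢ proj₂ (key c v)

  good-sym : ∀ {u v c} → Good u v c → Good v u c
  good-sym g eq = g (sym eq) ∘ sym

  cut-sym : ∀ {u v c} → Cut u v c → Cut v u c
  cut-sym (eq , neq) = sym eq , neq ∘ sym

  data TiedVia (c : Colour) (u : V) : V → Set where
    viaLeaf   : Leaf u → u ≢ r → p u ≢ r → TiedVia c u (p u)
    viaTurned : Turned u → colour u ≡ c → TiedVia c u u

  -- A tied subtree is a single leaf, or a turned top with leaves below it. So `q` is the parent of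
  -- `u` if `u` is a leaf, and `u` itself if `u` is the turned top.
  tied-via : ∀ c {u q} → tie (top c u) ≡ just q → TiedVia c u q
  tied-via c {u} eq with top c u in e | tie-sound eq | top-child c u
  ... | _ | leafTie leaf s≢r ps≢r    | inj₁ refl                             = viaLeaf leaf s≢r ps≢r
  ... | _ | leafTie leaf _ _         | inj₂ (y , y≢r , py≡ , _)              = contradiction py≡ (leaf y y≢r)
  ... | _ | turnedTie turned leaves  | inj₁ refl                             = viaTurned turned (top-self-colour (turned⇒≢r turned) e)
  ... | _ | turnedTie turned leaves  | inj₂ (y , y≢r , py≡ , inj₂ ¬leaf)     = contradiction (leaves y y≢r py≡) ¬leaf
  ... | _ | turnedTie turned leaves  | inj₂ (_ , u≢r , refl , inj₁ refl)     = viaLeaf (leaves u u≢r refl) u≢r (turned⇒≢r turned)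

  label-injective : ∀ {s t} → label s (tie s) ≡ label t (tie t) →
                    s ≡ t ⊎ ∃[ q ] ∃[ q′ ] (tie s ≡ just q × tie t ≡ just q′ × p q ≡ p q′)
  label-injective {s} {t} eq with tie s | tie t
  ... | nothing | nothing = inj₁ (inj₁-injective eq)
  ... | just q  | just q′ = inj₂ (q , q′ , refl , refl , inj₂-injective eq)
  label-injective () | nothing | just _
  label-injective () | just _  | nothing

  join-injective : ∀ {x y : V ⊎ V} → join n n x ≡ join n n y → x ≡ y
  join-injective {x} {y} eq = trans (sym (splitAt-join n n x)) (trans (cong (splitAt n) eq) (splitAt-join n n y))

  key-injective : ∀ c {u v} → proj₁ (key c u) ≡ proj₁ (key c v) →
                  top c u ≡ top c v ⊎ ∃[ q ] ∃[ q′ ] (tie (top c u) ≡ just q × tie (top c v) ≡ just q′ × p q ≡ p q′)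
  key-injective c = label-injective ∘ join-injective

  -- Cut probabilities of tree and non-tree edges

  same-top⇒cut : ∀ {c u v} → top c u ≡ top c v → parity (d u) ≢ parity (d v) → Cut u v c
  same-top⇒cut {c} {u} {v} eq neq = cong (λ s → join n n (label s (tie s))) eq
    , subst (λ s → parity (d u) ⊕ sign (tie (top c u)) ≢ parity (d v) ⊕ sign (tie s)) eq (⊕-injectiveˡ _ neq)

  tied⇒cut : ∀ {c u v q q′} → tie (top c u) ≡ just q → tie (top c v) ≡ just q′ → d u ≡ d v →
             q ≢ r → q′ ≢ r → p q ≡ p q′ → q ≢ q′ → Cut u v c
  tied⇒cut {c} {u} {v} {q} {q′} eq eq′ d≡ q≢r q′≢r pq≡ q≢q′ rewrite eq | eq′ | d≡ =
    cong (λ z → join n n (inj₂ z)) pq≡ , ⊕-injectiveʳ (parity (d v)) (second-differs q≢r q′≢r pq≡ q≢q′)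

  not-nephew : ∀ {u v} → Turned u → NonTree u v → p v ≢ r → p u ≢ p (p v)
  not-nephew tu nt pv≢r eq = ℕₚ.1+n≢n (trans (sym (depth-child pv≢r (sym eq)))
    (sym (cousins⇒parent-depth (proj₁ (turned-neighbour tu nt)))))

  -- Different subtrees sharing a bit are both tied at one vertex. Two leaves are then cousins,
  -- since adjacent siblings would give a triangle, and their signs are opposite; the other
  -- combinations contradict that a turned vertex has only a cousin as non-tree neighbour.
  nonTree-good : ∀ {c u v} → NonTree u v → top c u ≢ top c v → Good u v c
  nonTree-good {c} {u} {v} nt top≢ key≡ with key-injective c {u} {v} key≡
  ... | inj₁ top≡ = contradiction top≡ top≢
  ... | inj₂ (q , q′ , tq , tq′ , pq≡) with tied-via c {u} tq | tied-via c {v} tq′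
  ...   | viaLeaf _ u≢r pu≢r | viaLeaf _ v≢r pv≢r =
          proj₂ (tied⇒cut {c} {u} {v} tq tq′ d≡ pu≢r pv≢r pq≡ λ pu≡pv → siblings-nonadjacent u≢r v≢r pu≡pv (proj₁ nt))
    where
    d≡ : d u ≡ d v
    d≡ = trans (depth-child u≢r refl) (trans (cong suc (trans (depth-child pu≢r pq≡) (sym (depth-suc pv≢r)))) (sym (depth-suc v≢r)))
  ...   | viaTurned tu _ | viaLeaf _ v≢r pv≢r = ⊥-elim (not-nephew tu nt pv≢r pq≡)
  ...   | viaLeaf _ u≢r pu≢r | viaTurned tv _ = ⊥-elim (not-nephew tv (nonTree-sym nt) pu≢r (sym pq≡))
  ...   | viaTurned tu _ | viaTurned _ _ = contradiction pq≡ (proj₂ (proj₂ (proj₁ (turned-neighbour tu nt))))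

  tree-cut : ∀ {c v} → v ≢ r → c ≢ colour v → Cut v (p v) c
  tree-cut {c} {v} v≢r c≢ = same-top⇒cut {c} {v} {p v} (top-up v≢r (c≢ ∘ sym))
    λ eq → not-≢ _ (trans (cong parity (sym (depth-suc v≢r))) eq)

  -- The edge is deleted in this class, so the tops of its ends differ. The subtree of `p v` is not
  -- tied: `p v` has the child `v`, and as a turned top it would have the same colour as `v`.
  tree-good : ∀ {v} → v ≢ r → Good v (p v) (colour v)
  tree-good {v} v≢r key≡ with key-injective (colour v) {v} {p v} key≡
  ... | inj₁ top≡ = contradiction (subst (λ s → d s ℕ.≤ d (p v)) (trans (sym top≡) (top-here v≢r refl)) (top-depth (colour v) (p v)))
                      (ℕₚ.<⇒≱ (parent-depth< v≢r))
  ... | inj₂ (_ , _ , _ , tq′ , _) with tied-via (colour v) {p v} tq′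
  ...   | viaLeaf leaf _ _ = contradiction refl (leaf v v≢r)
  ...   | viaTurned _ eq   = contradiction (sym eq) (colour≢parent v≢r)

  near-depth : ∀ {z u} → Near z u → (u ≡ z) ⊎ d z ℕ.< d u
  near-depth at₀                  = inj₁ refl
  near-depth (at₁ u≢r refl)       = inj₂ (parent-depth< u≢r)
  near-depth (at₂ u≢r pu≢r refl)  = inj₂ (ℕₚ.<-trans (parent-depth< pu≢r) (parent-depth< u≢r))

  -- Cases by the distances from `z`: 0 and 0 is a loop, 0 and 1 a tree edge, 0 and 2 or 1 and 1
  -- closes a triangle, 1 and 2 has the wrong parity. Only 2 and 2 remains.
  shared-top⇒cousins : ∀ {z u v} → NonTree u v → parity (d u) ≡ parity (d v) → Near z u → Near z v → Cousins u v
  shared-top⇒cousins (a , _) _ at₀ at₀ = ⊥-elim (loopless a)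
  shared-top⇒cousins (_ , ¬uv , _) _ at₀ (at₁ v≢r pv≡u) = contradiction (v≢r , sym pv≡u) ¬uv
  shared-top⇒cousins (_ , _ , ¬vu) _ (at₁ u≢r pu≡v) at₀ = contradiction (u≢r , sym pu≡v) ¬vu
  shared-top⇒cousins (a , _) _ at₀ (at₂ v≢r pv≢r eq) = ⊥-elim (triangleFree (A-parent v≢r) (subst (A _) eq (A-parent pv≢r)) (A-sym a))
  shared-top⇒cousins (a , _) _ (at₂ u≢r pu≢r eq) at₀ = ⊥-elim (triangleFree (A-parent u≢r) (subst (A _) eq (A-parent pu≢r)) a)
  shared-top⇒cousins (a , _) _ (at₁ u≢r pu≡) (at₁ v≢r pv≡) = ⊥-elim (siblings-nonadjacent u≢r v≢r (trans pu≡ (sym pv≡)) a)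
  shared-top⇒cousins _ par (at₁ u≢r pu≡) (at₂ v≢r pv≢r eq) = contradiction
    (trans (sym (cong parity (trans (depth-suc v≢r) (cong suc (depth-child pv≢r eq)))))
      (trans (sym par) (cong parity (depth-child u≢r pu≡)))) (not-≢ _)
  shared-top⇒cousins _ par (at₂ u≢r pu≢r eq) (at₁ v≢r pv≡) = contradiction
    (trans (sym (cong parity (trans (depth-suc u≢r) (cong suc (depth-child pu≢r eq)))))
      (trans par (cong parity (depth-child v≢r pv≡)))) (not-≢ _)
  shared-top⇒cousins (a , _) _ (at₂ u≢r pu≢r eq) (at₂ v≢r pv≢r eq′) =
    trans (depth-suc u≢r) (trans (cong suc (trans (depth-child pu≢r eq) (sym (depth-child pv≢r eq′)))) (sym (depth-suc v≢r)))
    , trans eq (sym eq′) , λ pu≡pv → siblings-nonadjacent u≢r v≢r pu≡pv a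

  -- The colours of `v`, `p v` and `p (p v)` are all three colours, so `c`, not being the last, is
  -- one of the first two.
  low-top : ∀ {c v} → ¬ Turned v → v ≢ r → p v ≢ r → c ≢ colour (p (p v)) → top c v ≡ v ⊎ top c v ≡ p v
  low-top {c} {v} ¬t v≢r pv≢r c≢ with colour v ≟ c
  ... | yes eq = inj₁ (top-here v≢r eq)
  ... | no n₀ with colour (p v) ≟ c
  ...   | yes eq = inj₂ (trans (top-up v≢r n₀) (top-here pv≢r eq))
  ...   | no n₁ = contradiction (trans (colour-unturned² v≢r pv≢r ¬t)
                    (sym (third-unique _ _ c (colour≢parent pv≢r) (n₁ ∘ sym) c≢))) n₀

  cousins-low-tops : ∀ {u v a b} → Cousins u v → u ≢ v → (a ≡ u ⊎ a ≡ p u) → (b ≡ v ⊎ b ≡ p v) → a ≢ b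
  cousins-low-tops cs u≢v (inj₁ refl) (inj₁ refl) = u≢v
  cousins-low-tops cs u≢v (inj₂ refl) (inj₂ refl) = proj₂ (proj₂ cs)
  cousins-low-tops cs u≢v (inj₁ refl) (inj₂ refl) =
    depth<⇒≢ (subst (ℕ._< d _) (cousins⇒parent-depth cs) (parent-depth< (cousins⇒≢r cs))) ∘ sym
  cousins-low-tops cs u≢v (inj₂ refl) (inj₁ refl) =
    depth<⇒≢ (subst (ℕ._< d _) (sym (cousins⇒parent-depth cs)) (parent-depth< (cousins⇒≢r (cousins-sym cs))))

  -- In the class of `colour (p (p u))`, which turning gives to `u`, the top of `u` is `u`, at the
  -- depth of `v` and hence not above it. In the other classes the top of `v` is `v` or `p v`, while
  -- that of `u` is `p u` or lies higher.
  turned-tops-differ : ∀ c {u v} → Turned u → Cousins u v → u ≢ v → ¬ Turned v → top c u ≢ top c v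
  turned-tops-differ c {u} {v} tu cs u≢v ¬tv with c ≟ colour (p (p u))
  ... | yes c≡ = λ eq → [ (λ v≡u → u≢v (sym v≡u)) , (λ lt → ℕₚ.<⇒≢ lt (proj₁ cs)) ]′
                    (near-depth (subst (λ z → Near z v) (trans (sym eq) (top-here u≢r (trans (colour-turned² u≢r pu≢r tu) (sym c≡)))) (top-near c ¬tv)))
    where
    u≢r  = cousins⇒≢r cs
    pu≢r = cousins⇒parent≢r cs
  ... | no c≢ = λ eq → differ (trans (sym (top-up u≢r (λ e → c≢ (trans (sym e) (colour-turned² u≢r pu≢r tu))))) eq)
    where
    u≢r  = cousins⇒≢r cs
    pu≢r = cousins⇒parent≢r cs
    v≢r  = cousins⇒≢r (cousins-sym cs)
    pv≢r = cousins⇒parent≢r (cousins-sym cs)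
    differ : top c (p u) ≢ top c v
    differ eq with low-top ¬tv v≢r pv≢r (λ e → c≢ (trans e (cong colour (sym (proj₁ (proj₂ cs))))))
    ... | inj₁ top≡v = ℕₚ.<⇒≱ (parent-depth< v≢r)
            (subst₂ (λ s t → d s ℕ.≤ t) (trans eq top≡v) (cousins⇒parent-depth cs) (top-depth c (p u)))
    ... | inj₂ top≡pv with colour (p u) ≟ c
    ...   | yes e = proj₂ (proj₂ cs) (trans (sym (top-here pu≢r e)) (trans eq top≡pv))
    ...   | no ne = ℕₚ.<⇒≱ (parent-depth< pu≢r)
            (subst₂ (λ s t → s ℕ.≤ d t) (trans (cong d (trans (sym (top-up pu≢r ne)) (trans eq top≡pv))) (sym (cousins⇒parent-depth cs)))
              refl (top-depth c (p (p u))))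

  Compensated : V → V → Set
  Compensated u v = ∃[ α ] ∃[ γ ] (γ ≢ α × (∀ c → c ≢ α → Good u v c) × Cut u v γ)

  compensated-sym : ∀ {u v} → Compensated u v → Compensated v u
  compensated-sym {u} {v} (α , γ , γ≢α , good , cut) =
    α , γ , γ≢α , (λ c c≢α → good-sym {u} {v} {c} (good c c≢α)) , cut-sym {u} {v} {γ} cut

  leaf-unturned : ∀ {v} → Leaf v → ¬ Turned v
  leaf-unturned leaf (¬leaf , _) = ¬leaf leaf

  module LeafCousins {u v} (cs : Cousins u v) (nt : NonTree u v) (leafᵘ : Leaf u) (leafᵛ : Leaf v) where
    u≢r  = cousins⇒≢r cs
    pu≢r = cousins⇒parent≢r cs
    v≢r  = cousins⇒≢r (cousins-sym cs)
    pv≢r = cousins⇒parent≢r (cousins-sym cs)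
    -- In this class none of the edges between the leaves and their grandparent is deleted: they
    -- share a subtree at even distance and are never cut.
    α    = colour (p (p u))

    u≢v : u ≢ v
    u≢v refl = loopless (proj₁ nt)

    α-v : colour (p (p v)) ≡ α
    α-v = cong colour (sym (proj₁ (proj₂ cs)))

    good : ∀ c → c ≢ α → Good u v c
    good c c≢α = nonTree-good {c} nt (cousins-low-tops cs u≢v
      (low-top (leaf-unturned leafᵘ) u≢r pu≢r c≢α)
      (low-top (leaf-unturned leafᵛ) v≢r pv≢r (λ e → c≢α (trans e α-v))))

    colour-u : colour u ≡ third (colour (p u)) α
    colour-u = colour-unturned² u≢r pu≢r (leaf-unturned leafᵘ)

    colour-v : colour v ≡ third (colour (p v)) α
    colour-v = trans (colour-unturned² v≢r pv≢r (leaf-unturned leafᵛ)) (cong (third (colour (p v))) α-v)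

    tieᵘ : ∀ {c} → top c u ≡ u → tie (top c u) ≡ just (p u)
    tieᵘ top≡u = trans (cong tie top≡u) (tie-leaf leafᵘ u≢r pu≢r)

    tieᵛ : ∀ {c} → top c v ≡ v → tie (top c v) ≡ just (p v)
    tieᵛ top≡v = trans (cong tie top≡v) (tie-leaf leafᵛ v≢r pv≢r)

    -- Then `u` and `v` have the same colour as well; in its class each is a subtree of its own, and
    -- the two are tied at the common grandparent.
    equal-parents : colour (p u) ≡ colour (p v) → Compensated u v
    equal-parents eq = α , colour u , colour≢grandparent u≢r pu≢r (leaf-unturned leafᵘ) , good
      , tied⇒cut {colour u} {u} {v} (tieᵘ {colour u} (top-here u≢r refl))
          (tieᵛ {colour u} (top-here v≢r (trans colour-v (trans (cong (λ b → third b α) (sym eq)) (sym colour-u)))))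
          (proj₁ cs) pu≢r pv≢r (proj₁ (proj₂ cs)) (proj₂ (proj₂ cs))

    -- The turned `p u` has colour `β`, the unturned `p v` the colour other than `α` and `β`, and so
    -- `v` has `β` again. In class `β` the subtrees topped by `p u` and by `v` are tied at the
    -- common grandparent.
    turned-parent : Turned (p u) → ¬ Turned (p v) → Compensated u v
    turned-parent tpu ¬tpv = α , γ , colour≢parent pu≢r , good
      , tied⇒cut {γ} {u} {v} tie-pu (tieᵛ {γ} (top-here v≢r γ-v)) (proj₁ cs) pu≢r pv≢r (proj₁ (proj₂ cs)) (proj₂ (proj₂ cs))
      where
      γ = colour (p u)
      β = proj₂ (colours (p (p u)))

      γ≡β : γ ≡ β
      γ≡β = colour-turned pu≢r tpu

      -- The leaf `u` is the only child of the turned `p u`, which is therefore pendant.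
      tie-pu : tie (top γ u) ≡ just (p u)
      tie-pu = trans (cong tie (trans (top-up u≢r (colour≢parent u≢r)) (top-here pu≢r refl)))
        (tie-pendant tpu λ y y≢r py≡ → subst Leaf (turned-child-unique tpu u≢r refl y≢r py≡) leafᵘ)

      colour-pv : colour (p v) ≡ third α β
      colour-pv = trans (colour-unturned pv≢r ¬tpv)
        (cong₂ third α-v (cong (proj₂ ∘ colours) (sym (proj₁ (proj₂ cs)))))

      α≢β : α ≢ β
      α≢β = colours-distinct (p (p u))

      γ-v : colour v ≡ γ
      γ-v = trans colour-v (trans (cong (λ b → third b α) colour-pv)
        (trans (sym (third-unique _ _ β (third-≢ˡ _ _ α≢β) (third-≢ʳ _ _ α≢β ∘ sym) (α≢β ∘ sym))) (sym γ≡β)))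

  -- Given the colours at the grandparent, the colour of its child depends only on whether that
  -- child is turned. Parents of different colours are thus one turned and one unturned.
  leaf-cousins : ∀ {u v} → Cousins u v → NonTree u v → Leaf u → Leaf v → Compensated u v
  leaf-cousins {u} {v} cs nt leafᵘ leafᵛ with colour (p u) ≟ colour (p v) | turned? (p u) | turned? (p v)
  ... | yes eq | _       | _       = LeafCousins.equal-parents cs nt leafᵘ leafᵛ eq
  ... | no _   | yes tu  | no ¬tv  = LeafCousins.turned-parent cs nt leafᵘ leafᵛ tu ¬tv
  ... | no _   | no ¬tu  | yes tv  = compensated-sym {v} {u} (LeafCousins.turned-parent (cousins-sym cs) (nonTree-sym nt) leafᵛ leafᵘ tv ¬tu)
  ... | no neq | yes tu  | yes tv  = contradiction
          (trans (colour-turned (cousins⇒parent≢r cs) tu) (trans (cong (proj₂ ∘ colours) (proj₁ (proj₂ cs)))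
            (sym (colour-turned (cousins⇒parent≢r (cousins-sym cs)) tv)))) neq
  ... | no neq | no ¬tu  | no ¬tv  = contradiction
          (trans (colour-unturned (cousins⇒parent≢r cs) ¬tu) (trans (cong (λ l → third (colour l) (proj₂ (colours l))) (proj₁ (proj₂ cs)))
            (sym (colour-unturned (cousins⇒parent≢r (cousins-sym cs)) ¬tv)))) neq

  -- A single inner end would be turned because the other end is a leaf; of two inner ends the
  -- smaller would be turned.
  cousins-leaves : ∀ {u v} → A u v → Cousins u v → ¬ Turned u → ¬ Turned v → Leaf u × Leaf v
  cousins-leaves {u} {v} a cs ¬tu ¬tv with leaf? u | leaf? v
  ... | yes lu | yes lv = lu , lv
  ... | no ¬lu | yes lv = contradiction (¬lu , v , a , cs , inj₁ lv) ¬tu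
  ... | yes lu | no ¬lv = contradiction (¬lv , u , A-sym a , cousins-sym cs , inj₁ lu) ¬tv
  ... | no ¬lu | no ¬lv with <-cmp u v
  ...   | tri< lt _ _   = contradiction (¬lu , v , a , cs , inj₂ lt) ¬tu
  ...   | tri> _ _ gt   = contradiction (¬lv , u , A-sym a , cousins-sym cs , inj₂ gt) ¬tv
  ...   | tri≈ _ refl _ = ⊥-elim (loopless a)

  turned-good : ∀ {u v} → NonTree u v → Turned u → ∀ c → Good u v c
  turned-good {u} {v} nt tu c = nonTree-good {c} nt (turned-tops-differ c tu cs u≢v ¬tv)
    where
    cs  = proj₁ (turned-neighbour tu nt)
    u≢v : u ≢ v
    u≢v refl = loopless (proj₁ nt)
    ¬tv : ¬ Turned v
    ¬tv tv with proj₂ (turned-neighbour tu nt) | proj₂ (turned-neighbour tv (nonTree-sym nt))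
    ... | inj₁ lv  | _        = proj₁ tv lv
    ... | _        | inj₁ lu  = proj₁ tu lu
    ... | inj₂ u<v | inj₂ v<u = Finₚ.<-asym u<v v<u

  nonTree-covered : ∀ {u v} → NonTree u v → (∀ c → Good u v c) ⊎ Compensated u v
  nonTree-covered {u} {v} nt with parity (d u) Boolₚ.≟ parity (d v)
  ... | no odd = inj₁ good
    where
    good : ∀ c → Good u v c
    good c with top c u ≟ top c v
    ... | yes eq = λ _ → proj₂ (same-top⇒cut {c} {u} {v} eq odd)
    ... | no neq = nonTree-good {c} nt neq
  ... | yes even with turned? u | turned? v
  ...   | yes tu | _      = inj₁ (turned-good nt tu)
  ...   | no _   | yes tv = inj₁ λ c → good-sym {v} {u} {c} (turned-good (nonTree-sym nt) tv c)
  ...   | no ¬tu | no ¬tv with any? (λ c → top c u ≟ top c v)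
  ...     | no none = inj₁ λ c → nonTree-good {c} nt λ eq → none (c , eq)
  ...     | yes (c , eq) = inj₂ (leaf-cousins cs nt (proj₁ leaves) (proj₂ leaves))
    where
    cs = shared-top⇒cousins nt even (subst (λ z → Near z u) eq (top-near c ¬tu)) (top-near c ¬tv)
    leaves = cousins-leaves (proj₁ nt) cs ¬tu ¬tv

  -- Scores summed over the three classes

  scores : V → V → Colour → ℕ
  scores u v c = score (key c u) (key c v)

  good-score : ∀ u v c → Good u v c → 1 ℕ.≤ scores u v c
  good-score u v c g with proj₁ (key c u) ≟ proj₁ (key c v)
  ... | no _   = s≤s z≤n
  ... | yes eq with proj₂ (key c u) | proj₂ (key c v) | g eq
  ...   | true  | true  | b≢ = contradiction refl b≢
  ...   | true  | false | _  = s≤s z≤n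
  ...   | false | true  | _  = s≤s z≤n
  ...   | false | false | b≢ = contradiction refl b≢

  cut-score : ∀ u v c → Cut u v c → 2 ℕ.≤ scores u v c
  cut-score u v c (eq , b≢) with proj₁ (key c u) ≟ proj₁ (key c v)
  ... | no neq = contradiction eq neq
  ... | yes _ with proj₂ (key c u) | proj₂ (key c v)
  ...   | true  | true  = contradiction refl b≢
  ...   | true  | false = ℕₚ.≤-refl
  ...   | false | true  = ℕₚ.≤-refl
  ...   | false | false = contradiction refl b≢

  good-total : ∀ u v → (∀ c → Good u v c) → 3 ℕ.≤ total (scores u v)
  good-total u v g = ℕₚ.+-mono-≤ (good-score u v _ (g _)) (ℕₚ.+-mono-≤ (good-score u v _ (g _)) (good-score u v _ (g _)))

  tree-total : ∀ {u v} → ParentOf u v ⊎ ParentOf v u → 5 ℕ.≤ total (scores u v)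
  tree-total {u} {v} (inj₁ (v≢r , refl)) = total-tree _ (colour v)
    (λ c c≢ → cut-score u v c (cut-sym {v} {u} {c} (tree-cut v≢r c≢)))
    (good-score u v _ (good-sym {v} {u} {colour v} (tree-good v≢r)))
  tree-total {u} {v} (inj₂ (u≢r , refl)) = total-tree _ (colour u)
    (λ c c≢ → cut-score u v c (tree-cut u≢r c≢)) (good-score u v _ (tree-good u≢r))

  edge-total : ∀ {u v} → A u v → 3 ℕ.≤ total (scores u v)
  edge-total {u} {v} a with ¬? (v ≟ r) ×-dec (u ≟ p v) | ¬? (u ≟ r) ×-dec (v ≟ p u)
  ... | yes uv | _      = ℕₚ.≤-trans (s≤s (s≤s (s≤s z≤n))) (tree-total (inj₁ uv))
  ... | no _   | yes vu = ℕₚ.≤-trans (s≤s (s≤s (s≤s z≤n))) (tree-total (inj₂ vu))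
  ... | no ¬uv | no ¬vu with nonTree-covered (a , ¬uv , ¬vu)
  ...   | inj₁ good = good-total u v good
  ...   | inj₂ (α , γ , γ≢α , good , cut) = total-compensated _ α γ γ≢α
          (λ c c≢α → good-score u v c (good c c≢α)) (cut-score u v γ cut)

-- Degrees and weights

Joins : Fin n → Fin n → Edge n → Set
Joins v a e = e ≡ (v , a) ⊎ e ≡ (a , v)

joins-functional : ∀ {v a b : Fin n} {e} → Joins v a e → Joins v b e → a ≡ b
joins-functional (inj₁ refl) (inj₁ refl) = refl
joins-functional (inj₁ refl) (inj₂ refl) = refl
joins-functional (inj₂ refl) (inj₁ refl) = refl
joins-functional (inj₂ refl) (inj₂ refl) = refl

joins-incident : ∀ {v a : Fin n} {e} → Joins v a e → T (incident v e)
joins-incident {v = v} (inj₁ refl) with v ≟ v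
... | yes _  = _
... | no v≢v = contradiction refl v≢v
joins-incident {v = v} {a} (inj₂ refl) with v ≟ a | v ≟ v
... | yes _ | _      = _
... | no _  | yes _  = _
... | no _  | no v≢v = contradiction refl v≢v

-- Each neighbour is sent to the position of its edge among the edges at `v`; that edge determines
-- the neighbour, so the map is injective.
neighbours≤degree : (G : Graph n) (v : Fin n) {k : ℕ} (f : Fin k → Fin n) →
  (∀ i → Adj (edges G) v (f i)) → Injective _≡_ _≡_ f → k ℕ.≤ degree G v
neighbours≤degree {n} G v f adj inj = Finₚ.injective⇒≤ {f = position} λ {i} {j} eq → inj
  (joins-functional (at i) (subst (Joins v (f j) ∘ lookup incidents) (sym eq) (at j)))
  where
  incidents = filterᵇ (incident v) (edges G)
  edge : ∀ {a} → Adj (edges G) v a → ∃[ e ] (e ∈ edges G × Joins v a e)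
  edge (inj₁ m) = _ , m , inj₁ refl
  edge (inj₂ m) = _ , m , inj₂ refl
  member : ∀ i → proj₁ (edge (adj i)) ∈ incidents
  member i = ∈-filter⁺ (T? ∘ incident v) (proj₁ (proj₂ (edge (adj i)))) (joins-incident (proj₂ (proj₂ (edge (adj i)))))
  position = index ∘ member
  at : ∀ i → Joins v (f i) (lookup incidents (position i))
  at i = subst (Joins v (f i)) (lookup-index (member i)) (proj₂ (proj₂ (edge (adj i))))

unique-lookup : ∀ {A : Set} {xs : List A} → Unique xs → Injective _≡_ _≡_ (lookup xs)
unique-lookup (x∉ ∷ u) {zero}  {zero}  _  = refl
unique-lookup (x∉ ∷ u) {zero}  {suc j} eq = contradiction eq (All.lookup x∉ (∈-lookup j))
unique-lookup (x∉ ∷ u) {suc i} {zero}  eq = contradiction (sym eq) (All.lookup x∉ (∈-lookup i))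
unique-lookup (x∉ ∷ u) {suc i} {suc j} eq = cong suc (unique-lookup u eq)

no-four-neighbours : (G : Graph n) → MaxDegreeAtMost G 3 → ∀ {v a b c e} →
  Adj (edges G) v a → Adj (edges G) v b → Adj (edges G) v c → Adj (edges G) v e →
  a ≢ b → a ≢ c → a ≢ e → b ≢ c → b ≢ e → c ≢ e → ⊥
no-four-neighbours G deg {v} {a} {b} {c} {e} va vb vc ve ab ac ae bc be ce = ℕₚ.<⇒≱ (ℕₚ.≤-refl {4})
  (ℕₚ.≤-trans (neighbours≤degree G v (lookup (a ∷ b ∷ c ∷ e ∷ []))
    (λ i → All.lookup (va ∷ vb ∷ vc ∷ ve ∷ []) (∈-lookup {xs = a ∷ b ∷ c ∷ e ∷ []} i))
    (unique-lookup ((ab ∷ ac ∷ ae ∷ []) ∷ (bc ∷ be ∷ []) ∷ (ce ∷ []) ∷ [] ∷ []))) (deg v))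

halves-+ : ∀ a b → halves (a ℕ.+ b) ≡ halves a + halves b
halves-+ zero    b = sym (ℚₚ.+-identityˡ _)
halves-+ (suc a) b = trans (cong (½ +_) (halves-+ a b)) (sym (ℚₚ.+-assoc ½ (halves a) (halves b)))

halves-mono : ∀ {a b} → a ℕ.≤ b → halves a ≤ halves b
halves-mono {b = zero}  ℕ.z≤n     = ℚₚ.≤-refl
halves-mono {b = suc b} ℕ.z≤n     = ℚₚ.+-mono-≤ (from-yes (0ℚ ℚₚ.≤? ½)) (halves-mono (ℕ.z≤n {b}))
halves-mono (ℕ.s≤s le) = ℚₚ.+-monoʳ-≤ ½ (halves-mono le)

weighted-total : (w : Weight n) (E : List (Edge n)) (q : Fin n → Fin n → Colour → ℕ) →
  weighted w E (λ i j → halves (total (q i j))) ≡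
  weighted w E (λ i j → halves (q i j (# 0))) +
    (weighted w E (λ i j → halves (q i j (# 1))) + weighted w E (λ i j → halves (q i j (# 2))))
weighted-total w []            q = refl
weighted-total w ((i , j) ∷ E) q = trans
  (cong₂ (λ s t → w i j * s + t)
    (trans (halves-+ (q i j (# 0)) _) (cong (halves (q i j (# 0)) +_) (halves-+ (q i j (# 1)) (q i j (# 2)))))
    (weighted-total w E q))
  (solve 7 (λ x a b c d e f → x :* (a :+ (b :+ c)) :+ (d :+ (e :+ f))
                            := (x :* a :+ d) :+ ((x :* b :+ e) :+ (x :* c :+ f))) refl
    (w i j) (halves (q i j (# 0))) (halves (q i j (# 1))) (halves (q i j (# 2))) _ _ _)

-- Five halves are three halves plus 1: each tree edge contributes its weight once more.
weighted-≥ : (w : Weight n) (q : Fin n → Fin n → ℕ) {E T : List (Edge n)} → T ⊆ E → NonNegOn w E →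
  (∀ {i j} → (i , j) ∈ E → 3 ℕ.≤ q i j) → (∀ {i j} → (i , j) ∈ T → 5 ℕ.≤ q i j) →
  halves 3 * wt w E + wt w T ≤ weighted w E (λ i j → halves (q i j))
weighted-≥ w q []                    _          _  _  = ℚₚ.≤-refl
weighted-≥ w q {(i , j) ∷ E} {T} (_ ∷ʳ τ) (w≥0 ∷ nn) e≥ t≥ = ℚₚ.≤-trans
  (ℚₚ.≤-reflexive (solve 4 (λ h x e t → h :* (x :+ e) :+ t := x :* h :+ (h :* e :+ t)) refl (halves 3) (w i j) (wt w E) (wt w T)))
  (ℚₚ.+-mono-≤ (ℚₚ.*-monoˡ-≤-nonNeg (w i j) {{nonNegative w≥0}} (halves-mono (e≥ (here refl))))
    (weighted-≥ w q τ nn (e≥ ∘ there) t≥))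
weighted-≥ w q {(i , j) ∷ E} {_ ∷ T} (refl ∷ τ) (w≥0 ∷ nn) e≥ t≥ = ℚₚ.≤-trans
  (ℚₚ.≤-reflexive (solve 4 (λ h x e t → h :* (x :+ e) :+ (x :+ t) := x :* (h :+ con 1ℚ) :+ (h :* e :+ t)) refl (halves 3) (w i j) (wt w E) (wt w T)))
  (ℚₚ.+-mono-≤ (ℚₚ.*-monoˡ-≤-nonNeg (w i j) {{nonNegative w≥0}} (halves-mono (t≥ (here refl))))
    (weighted-≥ w q τ nn (e≥ ∘ there) (t≥ ∘ there)))

one-of-three : ∀ {t} (x : Colour → ℚ) → t + (t + t) ≤ x (# 0) + (x (# 1) + x (# 2)) → ∃[ c ] (t ≤ x c)
one-of-three {t} x le with t ℚₚ.≤? x (# 0) | t ℚₚ.≤? x (# 1) | t ℚₚ.≤? x (# 2)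
... | yes p | _     | _     = # 0 , p
... | _     | yes p | _     = # 1 , p
... | _     | _     | yes p = # 2 , p
... | no a  | no b  | no c  = ⊥-elim (ℚₚ.<-irrefl refl
  (ℚₚ.<-≤-trans (ℚₚ.+-mono-< (ℚₚ.≰⇒> a) (ℚₚ.+-mono-< (ℚₚ.≰⇒> b) (ℚₚ.≰⇒> c))) le))

wt-nonNeg : (w : Weight n) {E T : List (Edge n)} → T ⊆ E → NonNegOn w E → 0ℚ ≤ wt w T
wt-nonNeg w []         _          = ℚₚ.≤-refl
wt-nonNeg w (_ ∷ʳ τ)   (_ ∷ nn)   = wt-nonNeg w τ nn
wt-nonNeg w (refl ∷ τ) (w≥0 ∷ nn) = ℚₚ.+-mono-≤ w≥0 (wt-nonNeg w τ nn)

-- Averaging over three classes turns the right side into 1/2 of `e` plus 1/3 of `t`, and `c₀` is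
-- below 1/3.
tripled-bound : ∀ e t → 0ℚ ≤ t → let s = ½ * e + c₀ * t in s + (s + s) ≤ halves 3 * e + t
tripled-bound e t t≥0 = ℚₚ.≤-trans
  (ℚₚ.≤-reflexive (solve 4 (λ h c e t → (h :* e :+ c :* t) :+ ((h :* e :+ c :* t) :+ (h :* e :+ c :* t))
     := (h :+ (h :+ (h :+ con 0ℚ))) :* e :+ (c :+ (c :+ c)) :* t) refl ½ c₀ e t))
  (ℚₚ.+-monoʳ-≤ (halves 3 * e) (ℚₚ.≤-trans
    (ℚₚ.*-monoʳ-≤-nonNeg t {{nonNegative t≥0}} (from-yes (c₀ + (c₀ + c₀) ℚₚ.≤? 1ℚ)))
    (ℚₚ.≤-reflexive (ℚₚ.*-identityˡ t))))

adj⇒≢ : (G : Graph n) → ∀ {i j} → Adj (edges G) i j → i ≢ j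
adj⇒≢ G (inj₁ m) = Finₚ.<⇒≢ (All.lookup (ordered G) m)
adj⇒≢ G (inj₂ m) = Finₚ.<⇒≢ (All.lookup (ordered G) m) ∘ sym

adj-mono : {E T : List (Edge n)} → T ⊆ E → ∀ {u v} → Adj T u v → Adj E u v
adj-mono τ = [ inj₁ ∘ ⊆-lookup τ , inj₂ ∘ ⊆-lookup τ ]′

-- Assembling the bound

rootedCut : (G : Graph n) (w : Weight n) → NonNegOn w (edges G) → TriangleFree G → MaxDegreeAtMost G 3 →
  {T : List (Edge n)} → T ⊆ edges G → Acyclic T → {r : Fin n} → Rooting T r →
  (∀ {x y} → Adj T r x → Adj T r y → x ≡ y) →
  ∃[ S ] (½ * wt w (edges G) + c₀ * wt w T ≤ cutWeight w (edges G) S)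
rootedCut G w nn tf deg {T} τ acyc R leafRooted = proj₁ cut , ℚₚ.≤-trans (proj₂ best) (proj₂ cut)
  where
  E = edges G
  open Labelling (Adj E) (adj? E) swap (λ ab bc ac → tf (_ , _ , _ , ab , bc , ac)) (no-four-neighbours G deg)
    R (adj-mono τ) leafRooted

  expected : Colour → ℚ
  expected c = weighted w E λ i j → halves (scores i j c)

  edge≥ : ∀ {i j} → (i , j) ∈ E → 3 ℕ.≤ total (scores i j)
  edge≥ {i} {j} m = edge-total {i} {j} (inj₁ m)

  tree≥ : ∀ {i j} → (i , j) ∈ T → 5 ℕ.≤ total (scores i j)
  tree≥ {i} {j} m = tree-total {i} {j} (TreeEdges.tree-edge R acyc (adj⇒≢ G (adj-mono τ (inj₁ m))) (inj₁ m))

  best : ∃[ c ] (½ * wt w E + c₀ * wt w T ≤ expected c)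
  best = one-of-three expected (ℚₚ.≤-trans (tripled-bound (wt w E) (wt w T) (wt-nonNeg w τ nn))
    (ℚₚ.≤-trans (weighted-≥ w (λ i j → total (scores i j)) τ nn edge≥ tree≥)
      (ℚₚ.≤-reflexive (weighted-total w E scores))))

  cut : ∃[ S ] (expected (proj₁ best) ≤ cutWeight w E S)
  cut = goodCut w E (key (proj₁ best))

-- Without vertices no root can be chosen, so this case stands apart.
emptyCut : (w : Weight 0) {E T : List (Edge 0)} → T ⊆ E → ∃[ S ] (½ * wt w E + c₀ * wt w T ≤ cutWeight w E S)
emptyCut w {[]}           {[]} [] = (λ ()) , ℚₚ.≤-refl
emptyCut w {(() , _) ∷ _} _

theorem5p5 : {n : ℕ} (G : Graph n) (w : Weight n) →
    NonNegOn w (edges G) → Connected (edges G) → TriangleFree G →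
    MaxDegreeAtMost G 3 → (T : List (Edge n)) → IsSpanningTree G T →
    ∃[ S ] (½ * wt w (edges G) + c₀ * wt w T ≤ cutWeight w (edges G) S)
theorem5p5 {zero} G w nn _ _ _ T (τ , _) = emptyCut w τ
theorem5p5 {suc _} G w nn _ tf deg T (τ , conn , acyc) =
  rootedCut G w nn tf deg τ acyc (rooting T (proj₁ root) conn) (proj₂ root)
  where root = leafRoot conn acyc (λ a → adj⇒≢ G (adj-mono τ a) refl)
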